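{- Let $S$ be a recurrent specular set on the finite alphabet $A$, let $X\subset S$ be its even code, and let $f:B^*\to A^*$ be a coding morphism for $X$, i.e. a morphism mapping the alphabet $B$ bijectively onto $X$. Then the decoding $f^{ -1}(S)$ is a union of two recurrent tree sets of characteristic $1$; more precisely, $f^{ -1}(S_{0,0})$ and $f^{ -1}(S_{1,1})$ are recurrent tree sets of characteristic $1$ (on the alphabets $f^{ -1}(X\cap S_{0,0})$ and $f^{ -1}(X\cap S_{1,1})$ respectively), and $f^{ -1}(S)$ is their union.
   Context: Words are over finite alphabets; $\varepsilon$ is the empty word. A set $S$ of words on $A$ is factorial if it contains $A$ and all the factors of its elements. For $w\in S$ let $L(w)=\{a\in A\mid aw\in S\}$, $R(w)=\{a\in A\mid wa\in S\}$, $B(w)=\{(a,b)\in A\times A\mid awb\in S\}$. A factorial set $S$ is biextendable if $B(w)\neq\emptyset$ for all $w\in S$. The extension graph $\mathcal{E}(w)$ is the undirected graph whose vertex set is the disjoint union of $L(w)$ and $R(w)$ and whose edges are the pairs in $B(w)$; the copy of $a\in L(w)$ is denoted $1\otimes a$ and the copy of $b\in R(w)$ is denoted $b\otimes1$. A biextendable set $S$ is a tree set of characteristic $c$ if $\mathcal{E}(w)$ is a tree for every nonempty $w\in S$ and $\mathcal{E}(\varepsilon)$ is a disjoint union of $c$ trees. Let $\theta$ be an involution on $A$ (possibly with fixed points) and let $G_\theta$ be the group generated by $A$ with relations $a\theta(a)=1$, $a\in A$ (so $a^{ -1}=\theta(a)$). A word is reduced if it has no factor $a\theta(a)$ with $a\in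 A$; the inverse of a reduced word $a_1\cdots a_n$ is the reduced word $\theta(a_n)\cdots\theta(a_1)$. A laminary set on $A$ relative to $\theta$ is a biextendable set of reduced words closed under taking inverses. A specular set is a laminary set which is a tree set of characteristic $2$. A set $S\ne\{\varepsilon\}$ is recurrent if it is factorial and for all $u,w\in S$ there is $v\in S$ with $uvw\in S$. Let $S$ be specular and let $\mathcal{T}_0,\mathcal{T}_1$ be the two trees forming $\mathcal{E}(\varepsilon)$. A letter $a$ is even if its two occurrences $1\otimes a$ and $a\otimes 1$ are in the same tree, and odd otherwise. A word of $S$ is even if it has an even number of (occurrences of) odd letters. The even code is the set of nonempty even words of $S$ having no proper nonempty even prefix; it is a bifix code. The parity graph of $S$ is the directed graph with vertices $0,1$ having, for each letter $a\in A$, exactly one edge labeled $a$, going from $i$ to $j$ where $a\otimes 1$ is a vertex of $\mathcal{T}_i$ and $1\otimes a$ is a vertex of $\mathcal{T}_j$. $S_{i,j}$ is the set of words of $S$ which are labels of a path from $i$ to $j$ in the parity graph (with $\varepsilon\in S_{0,0}\cap S_{1,1}$). -}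

module Defs where

open import Algebra.Morphism.Structures using (module MonoidMorphisms)
open import Data.Fin using (Fin)
open import Data.List using (List; []; _∷_; [_]; _++_; _∷ʳ_; map; reverse; length; ++-[]-rawMonoid)
open import Data.List.Properties using (++-identityʳ)
open import Data.List.Relation.Unary.All using (All)
open import Data.List.Relation.Unary.Linked using (Linked)
open import Data.List.Relation.Unary.Unique.Propositional using (Unique)
open import Data.Nat using (ℕ; suc; _≤_)
open import Data.Nat.Divisibility using (_∣_)
open import Data.Product using (∃; ∃₂; _×_; _,_)
open import Data.Sum using (_⊎_; inj₁; inj₂; [_,_]′)
open import Level using (0ℓ)
open import Relation.Binary using (Rel; Symmetric; Irreflexive; _⇔_)
open import Relation.Binary.Construct.Closure.ReflexiveTransitive using (Star)
open import Relation.Binary.PropositionalEquality using (_≡_; _≢_; refl; sym; cong)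
open import Relation.Nullary using (¬_)
open import Relation.Unary using (Pred; U; _∈_; _⊆_; _≐_; _⊢_; ｛_｝; Satisfiable)

private
  variable
    A B V : Set

-- Simple undirected graphs; the vertex set is a subset of the type V.

record Graph (V : Set) : Set₁ where
  field
    vertex       : Pred V 0ℓ
    edge         : Rel V 0ℓ
    symmetric    : Symmetric edge
    irreflexive  : Irreflexive _≡_ edge
    edge⇒vertex  : ∀ {x y} → edge x y → vertex x

open Graph public

Connected : Graph V → Set
Connected G = ∀ {x y} → vertex G x → vertex G y → Star (edge G) x y

-- A cycle has at least three vertices, all distinct.
Acyclic : Graph V → Set
Acyclic {V} G = ∀ (x : V) (xs : List V) →
  2 ≤ length xs → Unique (x ∷ xs) → ¬ Linked (edge G) (x ∷ xs ∷ʳ x)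

record IsTree (G : Graph V) : Set where
  field
    nonempty  : Satisfiable (vertex G)
    connected : Connected G
    acyclic   : Acyclic G

record IsDisjointUnionOfTrees (G : Graph V) {c : ℕ} (T : Fin c → Graph V) : Set where
  field
    vertices : vertex G ≐ (λ x → ∃ λ i → vertex (T i) x)
    edges    : edge G ⇔ (λ x y → ∃ λ i → edge (T i) x y)
    disjoint : ∀ {i j x} → vertex (T i) x → vertex (T j) x → i ≡ j
    trees    : ∀ i → IsTree (T i)

-- An alphabet is a subset P of a type of letters.

Factor : List A → List A → Set
Factor u w = ∃₂ λ p q → w ≡ p ++ u ++ q

record IsFactorial (P : Pred A 0ℓ) (S : Pred (List A) 0ℓ) : Set where
  field
    onAlphabet : S ⊆ All P
    letters    : ∀ {a} → P a → S [ a ]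
    factors    : ∀ {u w} → Factor u w → S w → S u

open IsFactorial public

LeftExt RightExt : Pred (List A) 0ℓ → List A → Pred A 0ℓ
LeftExt  S w a = S (a ∷ w)
RightExt S w b = S (w ∷ʳ b)

BiExt : Pred (List A) 0ℓ → List A → Pred (A × A) 0ℓ
BiExt S w (a , b) = S (a ∷ w ∷ʳ b)

record IsBiextendable (P : Pred A 0ℓ) (S : Pred (List A) 0ℓ) : Set where
  field
    isFactorial : IsFactorial P S
    extendable  : ∀ {w} → S w → Satisfiable (BiExt S w)

-- In the extension graph, inj₁ a is the vertex 1 ⊗ a given by a ∈ L(w), and
-- inj₂ b is the vertex b ⊗ 1 given by b ∈ R(w).

data ExtEdge (S : Pred (List A) 0ℓ) (w : List A) : Rel (A ⊎ A) 0ℓ where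
  left-right : ∀ {a b} → (a , b) ∈ BiExt S w → ExtEdge S w (inj₁ a) (inj₂ b)
  right-left : ∀ {a b} → (a , b) ∈ BiExt S w → ExtEdge S w (inj₂ b) (inj₁ a)

extensionGraph : {P : Pred A 0ℓ} {S : Pred (List A) 0ℓ} →
                 IsFactorial P S → List A → Graph (A ⊎ A)
extensionGraph {S = S} factorial w = record
  { vertex      = [ LeftExt S w , RightExt S w ]′
  ; edge        = ExtEdge S w
  ; symmetric   = λ { (left-right e) → right-left e ; (right-left e) → left-right e }
  ; irreflexive = λ { refl () }
  ; edge⇒vertex = λ
      { (left-right {a} {b} e) → factors factorial ([] , [ b ] , refl) e
      ; (right-left {a} {b} e) → factors factorial
          ([ a ] , [] , cong (a ∷_) (sym (++-identityʳ (w ∷ʳ b)))) e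
      }
  }

record IsTreeSet (P : Pred A 0ℓ) (S : Pred (List A) 0ℓ) (c : ℕ) : Set₁ where
  field
    isBiextendable : IsBiextendable P S
  open IsBiextendable isBiextendable public
  field
    nonempty-tree : ∀ {w} → S w → w ≢ [] → IsTree (extensionGraph isFactorial w)
    empty-forest  : ∃ λ (T : Fin c → Graph _) →
                    IsDisjointUnionOfTrees (extensionGraph isFactorial []) T

record IsRecurrent (P : Pred A 0ℓ) (S : Pred (List A) 0ℓ) : Set where
  field
    nontrivial  : ¬ (S ≐ ｛ [] ｝)
    isFactorial : IsFactorial P S
    recurrent   : ∀ {u w} → S u → S w → ∃ λ v → S v × S (u ++ v ++ w)

-- Laminary and specular sets have as alphabet all elements of A.

Reduced : (A → A) → Pred (List A) 0ℓ
Reduced θ w = ∀ a → ¬ Factor (a ∷ θ a ∷ []) w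

inverse : (A → A) → List A → List A
inverse θ w = reverse (map θ w)

record IsLaminary (θ : A → A) (S : Pred (List A) 0ℓ) : Set where
  field
    isBiextendable : IsBiextendable U S
    reduced        : S ⊆ Reduced θ
    inverse-closed : ∀ {w} → S w → S (inverse θ w)

record IsSpecular (θ : A → A) (S : Pred (List A) 0ℓ) : Set₁ where
  field
    isLaminary : IsLaminary θ S
    isTreeSet  : IsTreeSet U S 2
  open IsTreeSet isTreeSet public using (isFactorial)

-- T 0 and T 1 are the two trees forming the extension graph of the empty word.

module _ (T : Fin 2 → Graph (A ⊎ A)) where

  EvenLetter OddLetter : Pred A 0ℓ
  EvenLetter a = ∃ λ i → vertex (T i) (inj₁ a) × vertex (T i) (inj₂ a)
  OddLetter a = ¬ EvenLetter a

  -- The word has k occurrences of odd letters.  A relation, since oddness of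
  -- a letter is only decidable when every letter occurs in one of the trees.
  data OddCount : List A → ℕ → Set where
    []   : OddCount [] 0
    even : ∀ {a w k} → EvenLetter a → OddCount w k → OddCount (a ∷ w) k
    odd  : ∀ {a w k} → OddLetter a → OddCount w k → OddCount (a ∷ w) (suc k)

  -- Path i w j: the word w labels a path from i to j in the parity graph.
  ParityEdge : Fin 2 → A → Fin 2 → Set
  ParityEdge i a j = vertex (T i) (inj₂ a) × vertex (T j) (inj₁ a)

  data Path : Fin 2 → List A → Fin 2 → Set where
    []  : ∀ {i} → Path i [] i
    _∷_ : ∀ {i j k a w} → ParityEdge i a j → Path j w k → Path i (a ∷ w) k

module _ (S : Pred (List A) 0ℓ) (T : Fin 2 → Graph (A ⊎ A)) where

  EvenWord : Pred (List A) 0ℓ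
  EvenWord w = S w × ∃ λ k → OddCount T w k × 2 ∣ k

  EvenCode : Pred (List A) 0ℓ
  EvenCode w = w ≢ [] × EvenWord w ×
    (∀ u v → w ≡ u ++ v → u ≢ [] → v ≢ [] → ¬ EvenWord u)

  PathWords : Fin 2 → Fin 2 → Pred (List A) 0ℓ
  PathWords i j w = S w × Path T i w j

record IsCodingMorphism (f : List B → List A) (X : Pred (List A) 0ℓ) : Set where
  open MonoidMorphisms (++-[]-rawMonoid B) (++-[]-rawMonoid A)
  field
    isMonoidHomomorphism : IsMonoidHomomorphism f
    into                 : ∀ b → X (f [ b ])
    injective            : ∀ {b b′} → f [ b ] ≡ f [ b′ ] → b ≡ b′
    surjective           : ∀ {x} → X x → ∃ λ b → f [ b ] ≡ x

lettersOver : (List B → List A) → Pred (List A) 0ℓ → Pred B 0ℓ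
lettersOver f Y = [_] ⊢ f ⊢ Y

{-# OPTIONS --safe #-}
module Submission where

open import Defs
open import Algebra.Definitions using (Involutive)
open import Algebra.Morphism.Structures using (module MonoidMorphisms)
import Data.Fin as Fin
open import Data.Fin using (Fin)
open import Data.Fin.Patterns using (0F; 1F)
open import Data.List using (List; []; _∷_; [_]; _++_; _∷ʳ_; length; reverse)
import Data.List.Membership.Propositional as List
open import Data.List.Properties
  using (≡-dec; ++-assoc; ++-identityʳ; ++-conicalˡ; ++-conicalʳ; length-++-≤ˡ; length-++-≤ʳ;
         length-reverse; reverse-injective; unfold-reverse; reverse-++; reverse-involutive)
open import Data.List.Relation.Binary.Permutation.Propositional using (↭-sym)
open import Data.List.Relation.Binary.Permutation.Propositional.Properties
  using (All-resp-↭; ↭-reverse)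
open import Data.List.Relation.Unary.All as All using (All; []; _∷_)
open import Data.List.Relation.Unary.All.Properties using (¬Any⇒All¬; ++⁺; ++⁻ʳ; ∷ʳ⁺)
open import Data.List.Relation.Unary.AllPairs using ([]; _∷_)
open import Data.List.Relation.Unary.Any using (here; there; any?)
open import Data.List.Relation.Unary.Linked using (Linked; [-]; _∷_)
open import Data.List.Relation.Unary.Unique.Propositional using (Unique)
open import Data.Nat using (ℕ; zero; suc; s≤s; z≤n; _≤_; _<_; _⊔_)
open import Data.Nat.Divisibility using (_∣0; ∣-refl; ∣⇒≤)
open import Data.Nat.Properties using (≤-trans; ≤-pred; m≤m⊔n; m≤n⊔m)
open import Data.Product using (∃; ∃₂; _×_; _,_; -,_; proj₁; proj₂; swap)
open import Data.Sum as Sum using (_⊎_; inj₁; inj₂)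
open import Data.Sum.Properties as Sum using (inj₁-injective)
open import Function using (_∘_; flip; id; case_of_)
open import Level using (0ℓ)
open import Relation.Binary using (Rel; REL; _⇒_; Symmetric; DecidableEquality)
open import Relation.Binary.Construct.Closure.ReflexiveTransitive
  using (Star; ε; _◅_; _◅◅_; gmap)
  renaming (map to mapStar; reverse to reverseStar)
open import Relation.Binary.PropositionalEquality
  using (_≡_; _≢_; refl; sym; trans; cong; cong₂; subst; module ≡-Reasoning)
open import Relation.Nullary using (¬_; Dec; yes; no; contradiction)
open import Relation.Unary using (Pred; U; Satisfiable; _≐_; _∩_; _∪_; _⊢_)

-- The even code consists of the words of S that are either an even letter or
-- even letters between two odd ones, and every word of S labels a path of the
-- parity graph, which returns to its origin exactly on the words of X*.
-- Recurrence of S therefore passes to the decodings.  For w in S_{i,i}, the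
-- graph whose edges are the u, v in X ∩ S_{i,i} with u w v in S arises from
-- the tree T i or E(w) by prolonging letters to codewords, first on the right
-- and then on the left.  Each prolongation replaces a vertex by a tree
-- containing its neighbours, which preserves trees, and the process stops
-- since X is finite.
--
-- Membership in S being undecidable, trees are handled through walks:
-- acyclicity says that no walk joins the ends of an edge avoiding this edge.

private
  variable
    A L R L′ R′ V : Set

-- Bipartite trees

data BiEdge (E : REL L R 0ℓ) : Rel (L ⊎ R) 0ℓ where
  forth : ∀ {u v} → E u v → BiEdge E (inj₁ u) (inj₂ v)
  back  : ∀ {u v} → E u v → BiEdge E (inj₂ v) (inj₁ u)

Walk : REL L R 0ℓ → Rel (L ⊎ R) 0ℓ
Walk E = Star (BiEdge E)

infix 5 _∖⟨_,_⟩

_∖⟨_,_⟩ : REL L R 0ℓ → L → R → REL L R 0ℓ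
(E ∖⟨ u , v ⟩) u′ v′ = E u′ v′ × ¬ (u′ ≡ u × v′ ≡ v)

-- Only the non-isolated vertices of the bipartite graph E are considered.
record IsBiTree (E : REL L R 0ℓ) : Set where
  field
    connected : ∀ {u v u′ v′} → E u v → E u′ v′ → Walk E (inj₁ u) (inj₁ u′)
    bridge    : ∀ {u v} → E u v → ¬ Walk (E ∖⟨ u , v ⟩) (inj₁ u) (inj₂ v)

BiEdge-symmetric : {E : REL L R 0ℓ} → Symmetric (BiEdge E)
BiEdge-symmetric (forth e) = back e
BiEdge-symmetric (back e)  = forth e

BiEdge-gmap : {E : REL L R 0ℓ} {F : REL L′ R′ 0ℓ} (g : L → L′) (h : R → R′) →
              (∀ {u v} → E u v → F (g u) (h v)) →
              ∀ {x y} → BiEdge E x y → BiEdge F (Sum.map g h x) (Sum.map g h y)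
BiEdge-gmap g h E⇒F (forth e) = forth (E⇒F e)
BiEdge-gmap g h E⇒F (back e)  = back (E⇒F e)

Walk-gmap : {E : REL L R 0ℓ} {F : REL L′ R′ 0ℓ} (g : L → L′) (h : R → R′) →
            (∀ {u v} → E u v → F (g u) (h v)) →
            ∀ {x y} → Walk E x y → Walk F (Sum.map g h x) (Sum.map g h y)
Walk-gmap g h E⇒F = gmap (Sum.map g h) (BiEdge-gmap g h E⇒F)

BiEdge-flip : {E : REL L R 0ℓ} {F : REL R L 0ℓ} → (∀ {u v} → E u v → F v u) →
              ∀ {x y} → BiEdge E x y → BiEdge F (Sum.swap x) (Sum.swap y)
BiEdge-flip E⇒F (forth e) = back (E⇒F e)
BiEdge-flip E⇒F (back e)  = forth (E⇒F e)

IsBiTree-flip : {E : REL L R 0ℓ} → IsBiTree E → IsBiTree (flip E)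
IsBiTree-flip {E = E} t = record
  { connected = λ e e′ → gmap Sum.swap (BiEdge-flip {F = flip E} id)
                           (back e ◅ connected e e′ ◅◅ forth e′ ◅ ε)
  ; bridge    = λ e w → bridge e (reverseStar BiEdge-symmetric
                  (gmap Sum.swap (BiEdge-flip λ (e′ , ne) → e′ , ne ∘ swap) w))
  }
  where open IsBiTree t

IsBiTree-pullback :
  {E : REL L R 0ℓ} {F : REL L′ R′ 0ℓ} (g : L → L′) (h : R → R′) →
  (∀ {x y} → g x ≡ g y → x ≡ y) → (∀ {x y} → h x ≡ h y → x ≡ y) →
  (∀ {u v} → E u v → F (g u) (h v)) → (∀ {u v} → F (g u) (h v) → E u v) →
  (∀ {u v} → F u v → ∃₂ λ x y → g x ≡ u × h y ≡ v) →
  IsBiTree F → IsBiTree E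
IsBiTree-pullback {E = E} {F} g h g-inj h-inj E⇒F F⇒E onto t = record
  { connected = λ e e′ → lift (connected (E⇒F e) (E⇒F e′))
  ; bridge    = λ e w → bridge (E⇒F e)
      (Walk-gmap g h (λ (e′ , ne) → E⇒F e′ , λ (p , q) → ne (g-inj p , h-inj q)) w)
  }
  where
  open IsBiTree t
  lift : ∀ {u u′} → Walk F (inj₁ (g u)) (inj₁ (g u′)) → Walk E (inj₁ u) (inj₁ u′)
  lift w = go w refl refl
    where
    go : ∀ {u u′ x y} → Walk F x y → x ≡ inj₁ (g u) → y ≡ inj₁ (g u′) →
         Walk E (inj₁ u) (inj₁ u′)
    go ε refl q with refl ← g-inj (inj₁-injective q) = ε
    go (forth e ◅ back e′ ◅ w) refl q with onto e′
    ... | _ , _ , refl , refl = forth (F⇒E e) ◅ back (F⇒E e′) ◅ go w refl q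

IsBiTree-resp : {E F : REL L R 0ℓ} → (∀ {u v} → E u v → F u v) →
                (∀ {u v} → F u v → E u v) → IsBiTree F → IsBiTree E
IsBiTree-resp E⇒F F⇒E =
  IsBiTree-pullback id id id id E⇒F F⇒E λ _ → -, -, refl , refl

-- Replacing every right vertex a of a tree by a tree on the neighbours of a
-- and the new vertices a ∷ v gives a tree.
module _ (_≟L_ : DecidableEquality L) (_≟A_ : DecidableEquality A)
         {E : REL L A 0ℓ} {F : REL L (List A) 0ℓ}
         (no-[] : ∀ {u} → ¬ F u [])
         (project : ∀ {u a v} → F u (a ∷ v) → E u a)
         (lift : ∀ {u a} → E u a → ∃ λ v → F u (a ∷ v))
         (tree : IsBiTree E)
         (fibre : ∀ {u a} → E u a → IsBiTree (λ u v → F u (a ∷ v)))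
         where

  private
    module T = IsBiTree tree
    module Fibre {u a} (e : E u a) = IsBiTree (fibre e)

    Outside : A → REL L A 0ℓ
    Outside a u c = E u c × c ≢ a

    liftWalk : ∀ {u u′} → Walk E (inj₁ u) (inj₁ u′) → Walk F (inj₁ u) (inj₁ u′)
    liftWalk ε = ε
    liftWalk (forth {v = a} e ◅ back e′ ◅ w) =
      Walk-gmap id (a ∷_) id
        (Fibre.connected e (proj₂ (lift e)) (proj₂ (lift e′))) ◅◅ liftWalk w

    off-closed : ∀ {a h z} → E h a → E z a → Walk (Outside a) (inj₁ h) (inj₁ z) → h ≡ z
    off-closed {a} {h} {z} eh ez w with h ≟L z
    ... | yes h≡z = h≡z
    ... | no  h≢z = contradiction
      (mapStar (λ { (forth (e , c≢a)) → forth (e , c≢a ∘ proj₂)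
                  ; (back (e , c≢a))  → back (e , c≢a ∘ proj₂) }) w
        ◅◅ forth (ez , h≢z ∘ sym ∘ proj₁) ◅ ε)
      (T.bridge eh)

    -- An excursion of the walk outside the fibre of a returns to its starting
    -- point, hence can be removed.
    retract : ∀ {a u v h z} → E h a → Walk (Outside a) (inj₁ h) (inj₁ z) →
              Walk (F ∖⟨ u , a ∷ v ⟩) (inj₁ z) (inj₂ (a ∷ v)) →
              Walk ((λ u v → F u (a ∷ v)) ∖⟨ u , v ⟩) (inj₁ h) (inj₂ v)
    retract eh out (forth (e , ne) ◅ ε)
      with refl ← off-closed eh (project e) out
      = forth (e , λ { (refl , refl) → ne (refl , refl) }) ◅ ε
    retract eh out (forth {v = []} (e , _) ◅ back _ ◅ w) = contradiction e no-[]
    retract {a} eh out (forth {v = c ∷ y} (e , ne) ◅ back (e′ , ne′) ◅ w) with c ≟A a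
    ... | no c≢a =
      retract eh (out ◅◅ forth (project e , c≢a) ◅ back (project e′ , c≢a) ◅ ε) w
    ... | yes refl with refl ← off-closed eh (project e) out
      = forth (e , λ { (refl , refl) → ne (refl , refl) })
      ◅ back (e′ , λ { (refl , refl) → ne′ (refl , refl) })
      ◅ retract (project e′) ε w

  IsBiTree-refine : IsBiTree F
  IsBiTree-refine = record { connected = connected ; bridge = bridge }
    where
    connected : ∀ {u v u′ v′} → F u v → F u′ v′ → Walk F (inj₁ u) (inj₁ u′)
    connected {v = []}             e e′ = contradiction e no-[]
    connected {v = _ ∷ _} {v′ = []}    e e′ = contradiction e′ no-[]
    connected {v = _ ∷ _} {v′ = _ ∷ _} e e′ =
      liftWalk (T.connected (project e) (project e′))

    bridge : ∀ {u v} → F u v → ¬ Walk (F ∖⟨ u , v ⟩) (inj₁ u) (inj₂ v)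
    bridge {v = []}    e w = no-[] e
    bridge {v = _ ∷ _} e w = Fibre.bridge (project e) e (retract (project e) ε w)

-- V is a prefix code, and every long enough word of P has a prefix in V.
data Bar (V P : Pred (List A) 0ℓ) : Set₁ where
  stop : V [] → (∀ {v} → V v → v ≡ []) → Bar V P
  step : ¬ V [] → (∀ a → P [ a ] → Bar (V ∘ (a ∷_)) (P ∘ (a ∷_))) → Bar V P

PrefixClosed Extendable : REL L (List A) 0ℓ → Set
PrefixClosed E = ∀ {u} v v′ → E u (v ++ v′) → E u v
Extendable E = ∀ {u} v → E u v → ∃ λ b → E u (v ∷ʳ b)

Bar-meets : {V P : Pred (List A) 0ℓ} {E : REL L (List A) 0ℓ} → Bar V P →
            (∀ {u v} → E u v → P v) → Extendable E →
            ∀ {u} → E u [] → ∃ λ v → V v × E u v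
Bar-meets (stop V[] _) E⇒P ext e = [] , V[] , e
Bar-meets {E = E} (step _ bar) E⇒P ext {u} e =
  let b , e₁ = ext [] e
      v , Vv , e₂ = Bar-meets {E = λ u v → E u (b ∷ v)} (bar b (E⇒P e₁)) E⇒P
                      (ext ∘ (b ∷_)) e₁
  in b ∷ v , Vv , e₂

Bar-tree : DecidableEquality L → DecidableEquality A →
           {V P : Pred (List A) 0ℓ} {E : REL L (List A) 0ℓ} → Bar V P →
           (∀ {u v} → E u v → P v) → PrefixClosed E → Extendable E →
           (∀ {u} v → E u v → IsBiTree (λ u b → E u (v ∷ʳ b))) →
           ∀ {u} → E u [] → IsBiTree (λ u v → V v × E u v)
Bar-tree _ _ {V} {E = E} (stop V[] V≡[]) E⇒P closed ext trees _ = record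
  { connected = λ {u} {v} {u′} (v∈ , e) (v′∈ , e′) →
      forth (v∈ , e) ◅ back (v∈ , subst (E u′) (unique v′∈ v∈) e′) ◅ ε
  ; bridge    = λ { (v∈ , e) (forth ((v′∈ , _) , ne) ◅ _) →
                      ne (refl , unique v′∈ v∈) }
  }
  where
  unique : ∀ {v v′} → V v → V v′ → v ≡ v′
  unique v∈ v′∈ = trans (V≡[] v∈) (sym (V≡[] v′∈))
Bar-tree _≟L_ _≟A_ {E = E} (step ¬V[] bar) E⇒P closed ext trees e =
  IsBiTree-refine _≟L_ _≟A_ (¬V[] ∘ proj₁)
    (λ {_} {a} {v} (_ , e′) → closed [ a ] v e′)
    (λ {_} {a} e′ → Bar-meets {E = λ u v → E u (a ∷ v)} (bar a (E⇒P e′)) E⇒P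
                      (ext ∘ (a ∷_)) e′)
    (trees [] e)
    (λ {_} {a} e′ → Bar-tree _≟L_ _≟A_ {E = λ u v → E u (a ∷ v)} (bar a (E⇒P e′)) E⇒P
                      (closed ∘ (a ∷_)) (ext ∘ (a ∷_)) (trees ∘ (a ∷_)) e′)

-- E u v is read as: v and the reversal of u extend a common centre on the
-- right and on the left.
IsBiTree-extend :
  DecidableEquality A → {E : Rel (List A) 0ℓ} {W V P Q : Pred (List A) 0ℓ} →
  Bar W P → Bar V Q → (∀ {u v} → E u v → P u × Q v) →
  PrefixClosed E → PrefixClosed (flip E) → Extendable E → Extendable (flip E) →
  (∀ u v → E u v → IsBiTree (λ a b → E (u ∷ʳ a) (v ∷ʳ b))) →
  E [] [] → IsBiTree (λ u v → W u × V v × E u v)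
IsBiTree-extend _≟_ {E} {W} {V} barˡ barʳ E⇒P×Q closedʳ closedˡ extʳ extˡ trees e =
  IsBiTree-flip (Bar-tree (≡-dec _≟_) _≟_ barˡ (proj₁ ∘ E⇒P×Q ∘ proj₂) closed ext
    (λ u (v∈ , e′) → let _ , e₁ = extˡ u (closedʳ [] _ e′) in
      IsBiTree-flip (Bar-tree _≟_ _≟_ barʳ (proj₂ ∘ E⇒P×Q) closedʳ extʳ
        (λ v e₂ → trees u v (closedˡ u _ e₂)) e₁))
    (proj₂ (Bar-meets {E = E} barʳ (proj₂ ∘ E⇒P×Q) extʳ e)))
  where
  closed : PrefixClosed (λ v u → V v × E u v)
  closed u u′ (v∈ , e) = v∈ , closedˡ u u′ e
  ext : Extendable (λ v u → V v × E u v)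
  ext u (v∈ , e) = let b , e′ = extˡ u e in b , v∈ , e′

-- Acyclicity and bridges

data Track (R : Rel V 0ℓ) : V → List V → V → Set where
  []  : ∀ {x} → Track R x [] x
  _∷_ : ∀ {x y z xs} → R x y → Track R y xs z → Track R x (y ∷ xs) z

Track-map : {R S : Rel V 0ℓ} → R ⇒ S → ∀ {x xs y} → Track R x xs y → Track S x xs y
Track-map R⇒S []      = []
Track-map R⇒S (e ∷ t) = R⇒S e ∷ Track-map R⇒S t

module _ {R : Rel V 0ℓ} where

  Track-from : ∀ {x y z xs} → x List.∈ xs → Track R y xs z → Unique xs →
               ∃ λ ys → Track R x ys z × Unique (x ∷ ys)
  Track-from (here refl) (_ ∷ t) unique       = -, t , unique
  Track-from (there x∈)  (_ ∷ t) (_ ∷ unique) = Track-from x∈ t unique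

  Star⇒Track : DecidableEquality V → ∀ {x y} → Star R x y →
               ∃ λ xs → Track R x xs y × Unique (x ∷ xs)
  Star⇒Track _≟_ ε = [] , [] , [] ∷ []
  Star⇒Track _≟_ {x} (_◅_ {j = z} e w) with Star⇒Track _≟_ w
  ... | xs , t , unique with any? (x ≟_) (z ∷ xs)
  ...   | yes x∈ = Track-from x∈ (e ∷ t) unique
  ...   | no  x∉ = z ∷ xs , e ∷ t , ¬Any⇒All¬ _ x∉ ∷ unique

  Track⇒Linked : ∀ {x y z xs} → Track R x xs y → R y z → Linked R (x ∷ xs ∷ʳ z)
  Track⇒Linked []      e = e ∷ [-]
  Track⇒Linked (d ∷ t) e = d ∷ Track⇒Linked t e

Off : Rel V 0ℓ → V → V → Rel V 0ℓ
Off R x y a b = R a b × ¬ (a ≡ x × b ≡ y) × ¬ (a ≡ y × b ≡ x)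

module _ {V : Set} (G : Graph V) where

  Acyclic⇒bridge : DecidableEquality V → Acyclic G →
                   ∀ {x y} → edge G x y → ¬ Star (Off (edge G) x y) x y
  Acyclic⇒bridge _≟_ acyclic e w with Star⇒Track _≟_ w
  ... | _ , [] , _ = irreflexive G refl e
  ... | _ , (_ , ne , _) ∷ [] , _ = ne (refl , refl)
  ... | _ , t@(_ ∷ _ ∷ _) , unique =
    acyclic _ _ (s≤s (s≤s z≤n)) unique
      (Track⇒Linked (Track-map proj₁ t) (symmetric G e))

  bridge⇒Acyclic : (∀ {x y} → edge G x y → ¬ Star (Off (edge G) x y) x y) → Acyclic G
  bridge⇒Acyclic bridge x (y ∷ []) (s≤s ()) _ _
  bridge⇒Acyclic bridge x (y ∷ z ∷ xs) _
    ((x≢y ∷ x≢z ∷ x∉) ∷ (y≢z ∷ y∉) ∷ _) (e ∷ e′ ∷ l) =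
    bridge (symmetric G e)
      ((e′ , (λ (_ , p) → x≢z (sym p)) , λ (p , _) → x≢y (sym p)) ◅ go z xs (x≢z ∷ x∉) (y≢z ∷ y∉) l)
    where
    go : ∀ p ps → All (x ≢_) (p ∷ ps) → All (y ≢_) (p ∷ ps) →
         Linked (edge G) (p ∷ ps ∷ʳ x) → Star (Off (edge G) y x) p x
    go p []       (x≢p ∷ _) (y≢p ∷ _) (e ∷ [-]) =
      (e , (λ (q , _) → y≢p (sym q)) , λ (q , _) → x≢p (sym q)) ◅ ε
    go p (q ∷ ps) (x≢p ∷ x∉) (y≢p ∷ y∉) (e ∷ l) =
      (e , (λ (q , _) → y≢p (sym q)) , λ (q , _) → x≢p (sym q)) ◅ go q ps x∉ y∉ l

module _ {L R : Set} {G : Graph (L ⊎ R)} {E : REL L R 0ℓ}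
         (edge⇒E : ∀ {x y} → edge G x y → BiEdge E x y)
         (E⇒edge : ∀ {u v} → E u v → edge G (inj₁ u) (inj₂ v)) where

  private
    BiEdge⇒edge : ∀ {x y} → BiEdge E x y → edge G x y
    BiEdge⇒edge (forth e) = E⇒edge e
    BiEdge⇒edge (back e)  = symmetric G (E⇒edge e)

  IsTree⇒IsBiTree : DecidableEquality (L ⊎ R) → IsTree G → IsBiTree E
  IsTree⇒IsBiTree _≟_ tree = record
    { connected = λ e e′ → mapStar edge⇒E
        (connected (edge⇒vertex G (E⇒edge e)) (edge⇒vertex G (E⇒edge e′)))
    ; bridge    = λ e w → Acyclic⇒bridge G _≟_ acyclic (E⇒edge e) (mapStar off w)
    }
    where
    open IsTree tree
    off : ∀ {u v x y} → BiEdge (E ∖⟨ u , v ⟩) x y → Off (edge G) (inj₁ u) (inj₂ v) x y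
    off (forth (e , ne)) = E⇒edge e , (λ { (refl , refl) → ne (refl , refl) }) , λ ()
    off (back (e , ne))  =
      BiEdge⇒edge (back e) , (λ ()) , λ { (refl , refl) → ne (refl , refl) }

  IsBiTree⇒IsTree : Satisfiable (vertex G) →
                    (∀ {x} → vertex G x → ∃ λ y → edge G x y) →
                    IsBiTree E → IsTree G
  IsBiTree⇒IsTree nonempty adjacent tree = record
    { nonempty  = nonempty
    ; connected = λ vx vy →
        walk (edge⇒E (proj₂ (adjacent vx))) (edge⇒E (proj₂ (adjacent vy)))
    ; acyclic   = bridge⇒Acyclic G λ e w → bridges (edge⇒E e) w
    }
    where
    open IsBiTree tree
    walk : ∀ {x x′ y y′} → BiEdge E x x′ → BiEdge E y y′ → Star (edge G) x y
    walk (forth e) (forth e′) = mapStar BiEdge⇒edge (connected e e′)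
    walk (forth e) (back e′)  = mapStar BiEdge⇒edge (connected e e′ ◅◅ forth e′ ◅ ε)
    walk (back e)  (forth e′) = mapStar BiEdge⇒edge (back e ◅ connected e e′)
    walk (back e)  (back e′)  = mapStar BiEdge⇒edge (back e ◅ connected e e′ ◅◅ forth e′ ◅ ε)

    off : ∀ {x y u v} → BiEdge E x y → ¬ (x ≡ inj₁ u × y ≡ inj₂ v) →
          ¬ (x ≡ inj₂ v × y ≡ inj₁ u) → BiEdge (E ∖⟨ u , v ⟩) x y
    off (forth e) ne _  = forth (e , λ { (refl , refl) → ne (refl , refl) })
    off (back e)  _  ne = back (e , λ { (refl , refl) → ne (refl , refl) })

    bridges : ∀ {x y} → BiEdge E x y → ¬ Star (Off (edge G) x y) x y
    bridges (forth e) w =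
      bridge e (mapStar (λ (d , ne , ne′) → off (edge⇒E d) ne ne′) w)
    bridges (back e)  w =
      bridge e (reverseStar BiEdge-symmetric
        (mapStar (λ (d , ne , ne′) → off (edge⇒E d) ne′ ne) w))

-- The parity graph and the even code

opposite : ∀ {i j k : Fin 2} → i ≢ j → j ≢ k → i ≡ k
opposite {0F} {0F}      i≢j j≢k = contradiction refl i≢j
opposite {0F} {1F} {0F} i≢j j≢k = refl
opposite {0F} {1F} {1F} i≢j j≢k = contradiction refl j≢k
opposite {1F} {0F} {0F} i≢j j≢k = contradiction refl j≢k
opposite {1F} {0F} {1F} i≢j j≢k = refl
opposite {1F} {1F}      i≢j j≢k = contradiction refl i≢j

bounded : ∀ {m} (g : Fin m → ℕ) → ∃ λ k → ∀ i → g i ≤ k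
bounded {zero}  g = 0 , λ ()
bounded {suc m} g with bounded (g ∘ Fin.suc)
... | k , g≤k = g 0F ⊔ k , λ
  { 0F          → m≤m⊔n (g 0F) k
  ; (Fin.suc i) → ≤-trans (g≤k i) (m≤n⊔m (g 0F) k) }

module _ {P : Pred A 0ℓ} {S : Pred (List A) 0ℓ} (factorial : IsFactorial P S)
         (recurrent : ∀ {u w} → S u → S w → ∃ λ v → S v × S (u ++ v ++ w)) where

  recurrent⇒biextendable : ∀ {a x} → S (a ∷ x) → IsBiextendable P S
  recurrent⇒biextendable {a} {x} ax∈S = record
    { isFactorial = factorial ; extendable = extendable }
    where
    last-letter : ∀ (a : A) x → ∃₂ λ y b → a ∷ x ≡ y ∷ʳ b
    last-letter a []      = [] , a , refl
    last-letter a (b ∷ x) with last-letter b x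
    ... | y , c , eq = a ∷ y , c , cong (a ∷_) eq

    extendable : ∀ {w} → S w → Satisfiable (BiExt S w)
    extendable {w} w∈S with recurrent ax∈S w∈S
    ... | v , _ , axvw∈S with recurrent axvw∈S ax∈S | last-letter a (x ++ v)
    ...   | v′ , _ , s | y , b , eq with v′ ++ a ∷ x in eq′
    ...     | [] = contradiction (++-conicalʳ v′ _ eq′) λ ()
    ...     | c ∷ z = (b , c) , factors factorial (y , z , assoc) s
      where
      open ≡-Reasoning
      assoc : ((a ∷ x) ++ v ++ w) ++ c ∷ z ≡ y ++ (b ∷ w ∷ʳ c) ++ z
      assoc = begin
        ((a ∷ x) ++ v ++ w) ++ c ∷ z  ≡⟨ cong (_++ c ∷ z) (++-assoc (a ∷ x) v w) ⟨
        (((a ∷ x) ++ v) ++ w) ++ c ∷ z ≡⟨ cong (λ ◻ → (◻ ++ w) ++ c ∷ z) eq ⟩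
        ((y ∷ʳ b) ++ w) ++ c ∷ z      ≡⟨ cong (_++ c ∷ z) (++-assoc y [ b ] w) ⟩
        (y ++ b ∷ w) ++ c ∷ z         ≡⟨ ++-assoc y (b ∷ w) (c ∷ z) ⟩
        y ++ b ∷ w ++ c ∷ z           ≡⟨ cong (λ ◻ → y ++ b ∷ ◻) (++-assoc w [ c ] z) ⟨
        y ++ (b ∷ w ∷ʳ c) ++ z        ∎

module Parity
  {A : Set} (_≟_ : DecidableEquality A) {S : Pred (List A) 0ℓ} (treeSet : IsTreeSet U S 2)
  (recurrent : ∀ {u w} → S u → S w → ∃ λ v → S v × S (u ++ v ++ w))
  {T : Fin 2 → Graph (A ⊎ A)}
  (union : IsDisjointUnionOfTrees (extensionGraph (IsTreeSet.isFactorial treeSet) []) T)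
  where

  open IsTreeSet treeSet
  open IsDisjointUnionOfTrees union

  prefix : ∀ u v → S (u ++ v) → S u
  prefix u v = factors isFactorial ([] , v , refl)

  suffix : ∀ u v → S (u ++ v) → S v
  suffix u v = factors isFactorial (u , [] , cong (u ++_) (sym (++-identityʳ v)))

  private
    source-of : ∀ a → ∃ λ i → vertex (T i) (inj₂ a)
    source-of a = proj₁ vertices (letters isFactorial {a} _)

    target-of : ∀ a → ∃ λ i → vertex (T i) (inj₁ a)
    target-of a = proj₁ vertices (letters isFactorial {a} _)

  source target : A → Fin 2
  source = proj₁ ∘ source-of
  target = proj₁ ∘ target-of

  Even Odd : Pred A 0ℓ
  Even a = source a ≡ target a
  Odd a  = source a ≢ target a

  even? : ∀ a → Dec (Even a)
  even? a = source a Fin.≟ target a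

  source-unique : ∀ {i a} → vertex (T i) (inj₂ a) → i ≡ source a
  source-unique {a = a} v = disjoint v (proj₂ (source-of a))

  target-unique : ∀ {i a} → vertex (T i) (inj₁ a) → i ≡ target a
  target-unique {a = a} v = disjoint v (proj₂ (target-of a))

  parityEdge : ∀ a → ParityEdge T (source a) a (target a)
  parityEdge a = proj₂ (source-of a) , proj₂ (target-of a)

  Even⇒EvenLetter : ∀ {a} → Even a → EvenLetter T a
  Even⇒EvenLetter {a} e =
    target a , proj₂ (target-of a) ,
    subst (λ i → vertex (T i) (inj₂ a)) e (proj₂ (source-of a))

  EvenLetter⇒Even : ∀ {a} → EvenLetter T a → Even a
  EvenLetter⇒Even (_ , v , v′) = trans (sym (source-unique v′)) (target-unique v)

  target≡source : ∀ {a b} → S (a ∷ b ∷ []) → target a ≡ source b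
  target≡source ab∈S with proj₁ edges (left-right ab∈S)
  ... | i , e = trans (sym (target-unique (edge⇒vertex (T i) e)))
                      (source-unique (edge⇒vertex (T i) (symmetric (T i) e)))

  Path-++ : ∀ {i j k u v} → Path T i u j → Path T j v k → Path T i (u ++ v) k
  Path-++ []      q = q
  Path-++ (e ∷ p) q = e ∷ Path-++ p q

  Path-split : ∀ {i k} u {v} → Path T i (u ++ v) k → ∃ λ j → Path T i u j × Path T j v k
  Path-split []      p       = -, [] , p
  Path-split (_ ∷ u) (e ∷ p) with Path-split u p
  ... | j , q , r = j , e ∷ q , r

  Path-end : ∀ {i j j′ w} → Path T i w j → Path T i w j′ → j ≡ j′
  Path-end []            []              = refl
  Path-end ((_ , v) ∷ p) ((_ , v′) ∷ p′) with refl ← disjoint v v′ = Path-end p p′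

  path-∷ : ∀ {a w} → S (a ∷ w) → ∃ λ j → Path T (source a) (a ∷ w) j
  path-∷ {a} {[]}    _     = target a , parityEdge a ∷ []
  path-∷ {a} {b ∷ w} abw∈S with path-∷ (suffix [ a ] (b ∷ w) abw∈S)
  ... | j , p = j , parityEdge a ∷
    subst (λ i → Path T i (b ∷ w) j) (sym (target≡source (prefix (a ∷ b ∷ []) w abw∈S))) p

  path : ∀ {w} → S w → ∃₂ λ i j → Path T i w j
  path {[]}    _    = 0F , 0F , []
  path {a ∷ w} aw∈S = -, path-∷ aw∈S

  Path-even : ∀ {i j a} → Even a → ParityEdge T i a j → i ≡ j
  Path-even e (v , v′) = trans (source-unique v) (trans e (sym (target-unique v′)))

  Path-odd : ∀ {i j a} → Odd a → ParityEdge T i a j → i ≢ j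
  Path-odd o (v , v′) refl = o (trans (sym (source-unique v)) (target-unique v′))

  data Tail : Pred (List A) 0ℓ where
    last : ∀ {a} → Odd a → Tail [ a ]
    _∷_  : ∀ {a v} → Even a → Tail v → Tail (a ∷ v)

  data Block : Pred (List A) 0ℓ where
    even : ∀ {a} → Even a → Block [ a ]
    odd  : ∀ {a v} → Odd a → Tail v → Block (a ∷ v)

  Tail-∷ʳ : ∀ {e a} → All Even e → Odd a → Tail (e ∷ʳ a)
  Tail-∷ʳ []       o = last o
  Tail-∷ʳ (p ∷ ps) o = p ∷ Tail-∷ʳ ps o

  Tail-view : ∀ {v} → Tail v → ∃₂ λ e a → v ≡ e ∷ʳ a × All Even e × Odd a
  Tail-view (last o) = [] , _ , refl , [] , o
  Tail-view (p ∷ t) with Tail-view t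
  ... | e , a , refl , ps , o = _ ∷ e , a , refl , p ∷ ps , o

  All-reverse : ∀ {e} → All Even e → All Even (reverse e)
  All-reverse {e} = All-resp-↭ (↭-sym (↭-reverse e))

  Block-reverse : ∀ {x} → Block x → Block (reverse x)
  Block-reverse (even p) = even p
  Block-reverse (odd {a} o t) with Tail-view t
  ... | e , b , refl , ps , o′ = subst Block (sym eq) (odd o′ (Tail-∷ʳ (All-reverse ps) o))
    where
    eq : reverse (a ∷ e ∷ʳ b) ≡ b ∷ reverse e ∷ʳ a
    eq = trans (unfold-reverse a (e ∷ʳ b)) (cong (_∷ʳ a) (reverse-++ e [ b ]))

  Tail-bar : ∀ {V P : Pred (List A) 0ℓ} k → V ≐ Tail →
             (∀ {e} → All Even e → P e → length e < k) → Bar V P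
  Tail-bar {V} {P} k (V⊆Tail , Tail⊆V) bound = step (λ V[] → case V⊆Tail V[] of λ ()) (next k bound)
    where
    next : ∀ k → (∀ {e} → All Even e → P e → length e < k) →
           ∀ a → P [ a ] → Bar (V ∘ (a ∷_)) (P ∘ (a ∷_))
    next k bound a Pa with even? a
    ... | no o = stop (Tail⊆V (last o))
      (λ v∈ → case V⊆Tail v∈ of λ { (last _) → refl ; (p ∷ _) → contradiction p o })
    next zero bound a Pa | yes p = contradiction (bound (p ∷ []) Pa) λ ()
    next (suc k) bound a Pa | yes p = Tail-bar k
      ( (λ v∈ → case V⊆Tail v∈ of λ { (last o) → contradiction p o ; (_ ∷ t) → t })
      , λ t → Tail⊆V (p ∷ t))
      λ ps Pe → ≤-pred (bound (p ∷ ps) Pe)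

  Block-bar : ∀ {P : Pred (List A) 0ℓ} k →
              (∀ {a e} → Odd a → All Even e → P (a ∷ e) → length e < k) → Bar Block P
  Block-bar {P} k bound = step (λ ()) next
    where
    next : ∀ a → P [ a ] → Bar (Block ∘ (a ∷_)) (P ∘ (a ∷_))
    next a _ with even? a
    ... | yes p = stop (even p) λ { (even _) → refl ; (odd o _) → contradiction p o }
    ... | no o  = Tail-bar k
      ((λ { (even p) → contradiction p o ; (odd _ t) → t }) , odd o) (bound o)

  first-odd : ∀ w → All Even w ⊎ ∃₂ λ e a → ∃ λ r → w ≡ e ++ a ∷ r × All Even e × Odd a
  first-odd [] = inj₁ []
  first-odd (a ∷ w) with even? a | first-odd w
  ... | no o  | _       = inj₂ ([] , a , w , refl , [] , o)
  ... | yes p | inj₁ ps = inj₁ (p ∷ ps)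
  ... | yes p | inj₂ (e , b , r , refl , ps , o) =
    inj₂ (a ∷ e , b , r , refl , p ∷ ps , o)

  last-odd : ∀ w → All Even w ⊎ ∃₂ λ r a → ∃ λ e → w ≡ r ++ a ∷ e × All Even e × Odd a
  last-odd [] = inj₁ []
  last-odd (a ∷ w) with last-odd w
  ... | inj₂ (r , b , e , refl , ps , o) = inj₂ (a ∷ r , b , e , refl , ps , o)
  ... | inj₁ ps with even? a
  ...   | yes p = inj₁ (p ∷ ps)
  ...   | no o  = inj₂ ([] , a , w , refl , ps , o)

  OddCount-evens : ∀ {e k} → All Even e → OddCount T e k → k ≡ 0
  OddCount-evens []       []         = refl
  OddCount-evens (_ ∷ ps) (even _ c) = OddCount-evens ps c
  OddCount-evens (p ∷ _)  (odd o _)  = contradiction (Even⇒EvenLetter p) o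

  ¬EvenWord-odd∷evens : ∀ {a e} → Odd a → All Even e → ¬ EvenWord S T (a ∷ e)
  ¬EvenWord-odd∷evens o ps (_ , _ , even p _ , _) = o (EvenLetter⇒Even p)
  ¬EvenWord-odd∷evens o ps (_ , _ , odd _ c , 2∣k)
    with refl ← OddCount-evens ps c = contradiction (∣⇒≤ 2∣k) λ { (s≤s ()) }

  OddCount-tail : ∀ {v} → Tail v → OddCount T v 1
  OddCount-tail (last o) = odd (o ∘ EvenLetter⇒Even) []
  OddCount-tail (p ∷ t)  = even (Even⇒EvenLetter p) (OddCount-tail t)

  Block⇒EvenWord : ∀ {x} → S x → Block x → EvenWord S T x
  Block⇒EvenWord x∈S (even p)  = x∈S , 0 , even (Even⇒EvenLetter p) [] , 2 ∣0
  Block⇒EvenWord x∈S (odd o t) =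
    x∈S , 2 , odd (o ∘ EvenLetter⇒Even) (OddCount-tail t) , ∣-refl

  Tail-prefix : ∀ u {v} → Tail (u ++ v) → v ≢ [] → All Even u
  Tail-prefix []          t        v≢[] = []
  Tail-prefix (_ ∷ [])    (last _) v≢[] = contradiction refl v≢[]
  Tail-prefix (_ ∷ u)     (p ∷ t)  v≢[] = p ∷ Tail-prefix u t v≢[]

  Block⇒EvenCode : ∀ {x} → S x → Block x → EvenCode S T x
  Block⇒EvenCode {x} x∈S b =
    (λ { refl → case b of λ () }) , Block⇒EvenWord x∈S b , minimal b
    where
    minimal : ∀ {x} → Block x → ∀ u v → x ≡ u ++ v → u ≢ [] → v ≢ [] → ¬ EvenWord S T u
    minimal b         []           v refl u≢[] v≢[] = contradiction refl u≢[]
    minimal (even _)  (_ ∷ [])     v refl u≢[] v≢[] = contradiction refl v≢[]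
    minimal (odd o t) (_ ∷ u)      v refl u≢[] v≢[] =
      ¬EvenWord-odd∷evens o (Tail-prefix u t v≢[])

  EvenCode⇒S : ∀ {x} → EvenCode S T x → S x
  EvenCode⇒S (_ , (x∈S , _) , _) = x∈S

  EvenCode⇒Block : ∀ {x} → EvenCode S T x → Block x
  EvenCode⇒Block {[]} (x≢[] , _) = contradiction refl x≢[]
  EvenCode⇒Block {a ∷ x} _ with even? a
  EvenCode⇒Block {a ∷ []} _ | yes p = even p
  EvenCode⇒Block {a ∷ b ∷ x} (_ , (abx∈S , _) , minimal) | yes p = contradiction
    (Block⇒EvenWord (prefix [ a ] (b ∷ x) abx∈S) (even p))
    (minimal [ a ] (b ∷ x) refl (λ ()) (λ ()))
  EvenCode⇒Block {a ∷ x} (_ , word@(ax∈S , _) , minimal) | no o with first-odd x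
  ... | inj₁ ps = contradiction word (¬EvenWord-odd∷evens o ps)
  ... | inj₂ (e , b , [] , refl , ps , o′) = odd o (Tail-∷ʳ ps o′)
  ... | inj₂ (e , b , c ∷ r , refl , ps , o′) = contradiction
    (Block⇒EvenWord (prefix (a ∷ e ∷ʳ b) (c ∷ r) (subst S eq ax∈S)) (odd o (Tail-∷ʳ ps o′)))
    (minimal (a ∷ e ∷ʳ b) (c ∷ r) eq (λ ()) (λ ()))
    where
    eq : a ∷ e ++ b ∷ c ∷ r ≡ (a ∷ e ∷ʳ b) ++ c ∷ r
    eq = cong (a ∷_) (sym (++-assoc e [ b ] (c ∷ r)))

  Tail-path : ∀ {i j v} → Tail v → Path T i v j → i ≢ j
  Tail-path (last o) (e ∷ []) = Path-odd o e
  Tail-path (p ∷ t)  (e ∷ q)  with refl ← Path-even p e = Tail-path t q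

  Block-loop : ∀ {i j x} → Block x → Path T i x j → i ≡ j
  Block-loop (even p)  (e ∷ []) = Path-even p e
  Block-loop (odd o t) (e ∷ p)  = opposite (Path-odd o e) (Tail-path t p)

  Path-start-unique : ∀ {i i′ j j′ x} → x ≢ [] → Path T i x j → Path T i′ x j′ → i ≡ i′
  Path-start-unique x≢[] []            _               = contradiction refl x≢[]
  Path-start-unique x≢[] ((v , _) ∷ _) ((v′ , _) ∷ _) = disjoint v v′

  Path-end-unique : ∀ {i i′ j j′ x} → x ≢ [] → Path T i x j → Path T i′ x j′ → j ≡ j′
  Path-end-unique x≢[] p p′ with refl ← Path-start-unique x≢[] p p′ = Path-end p p′

  -- The extensions of the empty word, u being read from right to left, whose
  -- paths in the parity graph visit i between u and v.
  Around : Fin 2 → Rel (List A) 0ℓ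
  Around i u v = S (reverse u ++ v) × ∃₂ λ j k → Path T j (reverse u) i × Path T i v k

  Around-closedʳ : ∀ i → PrefixClosed (Around i)
  Around-closedʳ i {u} v v′ (s , _ , _ , p , q) =
    prefix (reverse u ++ v) v′ (subst S (sym (++-assoc (reverse u) v v′)) s) ,
    -, -, p , proj₁ (proj₂ (Path-split v q))

  Around-closedˡ : ∀ i → PrefixClosed (flip (Around i))
  Around-closedˡ i {v} u u′ (s , j , _ , p , q) =
    suffix (reverse u′) (reverse u ++ v)
      (subst S (trans (cong (_++ v) (reverse-++ u u′)) (++-assoc (reverse u′) (reverse u) v)) s) ,
    -, -,
    proj₂ (proj₂ (Path-split (reverse u′)
      (subst (λ x → Path T j x i) (reverse-++ u u′) p))) ,
    q

  centre-unique : ∀ {i i′ j j′ k k′ u v} u′ v′ → u ≢ [] ⊎ v ≢ [] →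
                  Path T j (reverse u) i → Path T i v k →
                  Path T j′ (reverse (u ++ u′)) i′ → Path T i′ (v ++ v′) k′ → i ≡ i′
  centre-unique {i′ = i′} {j′ = j′} {u = u} u′ v′ (inj₁ u≢[]) p q p′ q′ =
    Path-end-unique (u≢[] ∘ reverse-injective) p
      (proj₂ (proj₂ (Path-split (reverse u′)
        (subst (λ x → Path T j′ x i′) (reverse-++ u u′) p′))))
  centre-unique {v = v} u′ v′ (inj₂ v≢[]) p q p′ q′ =
    Path-start-unique v≢[] q (proj₁ (proj₂ (Path-split v q′)))

  Around-extend : ∀ {i u v} u′ v′ → u ≢ [] ⊎ v ≢ [] → Around i u v →
                  S (reverse (u ++ u′) ++ (v ++ v′)) → Around i (u ++ u′) (v ++ v′)
  Around-extend {u = u} u′ v′ ne (_ , _ , _ , p , q) s with path s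
  ... | _ , _ , r with Path-split (reverse (u ++ u′)) r
  ...   | _ , p′ , q′ with refl ← centre-unique {u = u} u′ v′ ne p q p′ q′ =
    s , -, -, p′ , q′

  nonempty-or-empty : ∀ (u v : List A) → (u ≢ [] ⊎ v ≢ []) ⊎ (u ≡ [] × v ≡ [])
  nonempty-or-empty []      []      = inj₂ (refl , refl)
  nonempty-or-empty []      (_ ∷ _) = inj₁ (inj₂ λ ())
  nonempty-or-empty (_ ∷ _) _       = inj₁ (inj₁ λ ())

  Around-edge : ∀ {i a b} → S (a ∷ b ∷ []) → vertex (T i) (inj₁ a) → Around i [ a ] [ b ]
  Around-edge {i} {a} {b} ab∈S v with proj₁ edges (left-right ab∈S)
  ... | k , e with refl ← disjoint v (edge⇒vertex (T k) e) =
    ab∈S , -, -, (proj₂ (source-of a) , v) ∷ [] ,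
    (edge⇒vertex (T i) (symmetric (T i) e) , proj₂ (target-of b)) ∷ []

  around : ∀ i → ∃₂ λ a b → Around i [ a ] [ b ]
  around i with IsTree.nonempty (trees i)
  ... | inj₁ a , v with extendable (letters isFactorial {a} _)
  ...   | (c , b) , cab∈S = a , b , Around-edge (suffix [ c ] (a ∷ b ∷ []) cab∈S) v
  around i | inj₂ b , v with extendable (letters isFactorial {b} _)
  ...   | (a , c) , abc∈S = a , b , Around-edge ab∈S
    (subst (λ j → vertex (T j) (inj₁ a))
      (trans (target≡source ab∈S) (sym (source-unique v))) (proj₂ (target-of a)))
    where
    ab∈S : S (a ∷ b ∷ [])
    ab∈S = prefix (a ∷ b ∷ []) [ c ] abc∈S

  extension-≡ : ∀ (u v : List A) a b →
                reverse (u ∷ʳ a) ++ (v ∷ʳ b) ≡ a ∷ (reverse u ++ v) ∷ʳ b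
  extension-≡ u v a b = trans (cong (_++ (v ∷ʳ b)) (reverse-++ u [ a ]))
                              (cong (a ∷_) (sym (++-assoc (reverse u) v [ b ])))

  Around-biextendable : ∀ {i} u v → Around i u v → ∃₂ λ a b → Around i (u ∷ʳ a) (v ∷ʳ b)
  Around-biextendable {i} u v r with nonempty-or-empty u v
  ... | inj₂ (refl , refl) = around i
  ... | inj₁ ne with extendable (proj₁ r)
  ...   | (a , b) , s =
    a , b , Around-extend [ a ] [ b ] ne r (subst S (sym (extension-≡ u v a b)) s)

  Around-extendableʳ : ∀ i → Extendable (Around i)
  Around-extendableʳ i {u} v r =
    let a , b , r′ = Around-biextendable u v r in b , Around-closedˡ i u [ a ] r′

  Around-extendableˡ : ∀ i → Extendable (flip (Around i))
  Around-extendableˡ i {v} u r =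
    let a , b , r′ = Around-biextendable u v r in a , Around-closedʳ i {u ∷ʳ a} v [ b ] r′

  Around-tree : ∀ i u v → Around i u v → IsBiTree (λ a b → Around i (u ∷ʳ a) (v ∷ʳ b))
  Around-tree i u v r with nonempty-or-empty u v
  ... | inj₁ ne = IsTree⇒IsBiTree edge⇒E
    (λ {a} {b} r′ → left-right (subst S (extension-≡ u v a b) (proj₁ r′)))
    (Sum.≡-dec _≟_ _≟_)
    (nonempty-tree (proj₁ r) (nonempty ne))
    where
    nonempty : u ≢ [] ⊎ v ≢ [] → reverse u ++ v ≢ []
    nonempty (inj₁ u≢[]) eq = u≢[] (reverse-injective (++-conicalˡ _ v eq))
    nonempty (inj₂ v≢[]) eq = v≢[] (++-conicalʳ (reverse u) v eq)

    E⇐ : ∀ {a b} → S (a ∷ (reverse u ++ v) ∷ʳ b) → Around i (u ∷ʳ a) (v ∷ʳ b)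
    E⇐ {a} {b} s = Around-extend [ a ] [ b ] ne r (subst S (sym (extension-≡ u v a b)) s)

    edge⇒E : ∀ {x y} → ExtEdge S (reverse u ++ v) x y →
             BiEdge (λ a b → Around i (u ∷ʳ a) (v ∷ʳ b)) x y
    edge⇒E (left-right s) = forth (E⇐ s)
    edge⇒E (right-left s) = back (E⇐ s)
  ... | inj₂ (refl , refl) = IsTree⇒IsBiTree edge⇒E E⇒edge (Sum.≡-dec _≟_ _≟_) (trees i)
    where
    edge⇒E : ∀ {x y} → edge (T i) x y → BiEdge (λ a b → Around i [ a ] [ b ]) x y
    edge⇒E e with proj₂ edges (i , e)
    ... | left-right s = forth (Around-edge s (edge⇒vertex (T i) e))
    ... | right-left s = back (Around-edge s (edge⇒vertex (T i) (symmetric (T i) e)))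

    E⇒edge : ∀ {a b} → Around i [ a ] [ b ] → edge (T i) (inj₁ a) (inj₂ b)
    E⇒edge (s , _ , _ , (_ , v) ∷ [] , _) with proj₁ edges (left-right s)
    ... | k , e with refl ← disjoint v (edge⇒vertex (T k) e) = e

  evens-bounded : ∀ {k} → (∀ {x} → EvenCode S T x → length x ≤ k) →
                  ∀ {a e} → Odd a → All Even e → S e → length e < k
  evens-bounded bound {a} {e} o ps e∈S
    with recurrent (letters isFactorial {a} _) e∈S
  ... | v , _ , ave∈S with recurrent ave∈S (letters isFactorial {a} _)
  ...   | v′ , _ , s with last-odd (a ∷ v) | first-odd (v′ ∷ʳ a)
  ...     | inj₁ (p ∷ _) | _ = contradiction p o
  ...     | inj₂ _ | inj₁ qs = contradiction (All.head (++⁻ʳ v′ qs)) o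
  ...     | inj₂ (r , c , g , eq , gs , o₁) | inj₂ (h , d , t , eq′ , hs , o₂) =
    ≤-trans (s≤s (≤-trans (length-++-≤ˡ e) (≤-trans (length-++-≤ʳ (e ++ h) {g})
              (length-++-≤ˡ (g ++ e ++ h)))))
            (bound (Block⇒EvenCode (factors isFactorial (r , t , assoc) s)
              (odd o₁ (Tail-∷ʳ (++⁺ gs (++⁺ ps hs)) o₂))))
    where
    open ≡-Reasoning
    assoc : (a ∷ v ++ e) ++ v′ ++ [ a ] ≡ r ++ (c ∷ (g ++ e ++ h) ∷ʳ d) ++ t
    assoc = begin
      ((a ∷ v) ++ e) ++ v′ ++ [ a ]       ≡⟨ cong₂ (λ x y → (x ++ e) ++ y) eq eq′ ⟩
      ((r ++ c ∷ g) ++ e) ++ h ++ d ∷ t   ≡⟨ ++-assoc (r ++ c ∷ g) e (h ++ d ∷ t) ⟩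
      (r ++ c ∷ g) ++ e ++ h ++ d ∷ t     ≡⟨ ++-assoc r (c ∷ g) (e ++ h ++ d ∷ t) ⟩
      r ++ c ∷ g ++ e ++ h ++ d ∷ t       ≡⟨ cong (λ x → r ++ c ∷ g ++ x) (++-assoc e h (d ∷ t)) ⟨
      r ++ c ∷ g ++ (e ++ h) ++ d ∷ t     ≡⟨ cong (λ x → r ++ c ∷ x) (++-assoc g (e ++ h) (d ∷ t)) ⟨
      r ++ c ∷ (g ++ e ++ h) ++ d ∷ t     ≡⟨ cong (λ x → r ++ c ∷ x) (++-assoc (g ++ e ++ h) [ d ] t) ⟨
      r ++ (c ∷ (g ++ e ++ h) ∷ʳ d) ++ t  ∎

  code-tree : ∀ {k} → (∀ {x} → EvenCode S T x → length x ≤ k) →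
              ∀ i w → Around i [] w → IsBiTree (λ u v → Block u × Block v × Around i u (w ++ v))
  code-tree {k} bound i w r = IsBiTree-extend _≟_
    {P = λ u → ∃ λ v → Around i u (w ++ v)} {Q = λ v → ∃ λ u → Around i u (w ++ v)}
    (Block-bar k boundˡ) (Block-bar k boundʳ) (λ {u} {v} e → (v , e) , (u , e))
    (λ {u} v v′ → Around-closedʳ i {u} (w ++ v) v′ ∘ subst (Around i u) (sym (++-assoc w v v′)))
    (λ {v} → Around-closedˡ i {w ++ v})
    (λ {u} v e → let b , e′ = Around-extendableʳ i {u} (w ++ v) e in
      b , subst (Around i u) (++-assoc w v [ b ]) e′)
    (λ {v} → Around-extendableˡ i {w ++ v})
    (λ u v e → IsBiTree-resp
      (λ {a} {b} → subst (Around i (u ∷ʳ a)) (sym (++-assoc w v [ b ])))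
      (λ {a} {b} → subst (Around i (u ∷ʳ a)) (++-assoc w v [ b ]))
      (Around-tree i u (w ++ v) e))
    (subst (Around i []) (sym (++-identityʳ w)) r)
    where
    boundˡ : ∀ {a e} → Odd a → All Even e → ∃ (λ v → Around i (a ∷ e) (w ++ v)) → length e < k
    boundˡ {a} {e} o ps (v , s , _) = subst (_< k) (length-reverse e)
      (evens-bounded bound o (All-reverse ps)
        (prefix (reverse e) [ a ]
          (subst S (unfold-reverse a e) (prefix (reverse (a ∷ e)) (w ++ v) s))))

    boundʳ : ∀ {a e} → Odd a → All Even e → ∃ (λ u → Around i u (w ++ a ∷ e)) → length e < k
    boundʳ {a} {e} o ps (u , s , _) = evens-bounded bound o ps
      (suffix [ a ] e (suffix w (a ∷ e) (suffix (reverse u) (w ++ a ∷ e) s)))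

  module Decoding {B : Set} {f : List B → List A} (coding : IsCodingMorphism f (EvenCode S T))
                  {k : ℕ} (bound : ∀ b → length (f [ b ]) ≤ k) where

    open IsCodingMorphism coding
    open MonoidMorphisms.IsMonoidHomomorphism isMonoidHomomorphism using (homo; ε-homo)

    code-bound : ∀ {x} → EvenCode S T x → length x ≤ k
    code-bound c with surjective c
    ... | b , refl = bound b

    encode : ∀ {x} → S x → Block x → ∃ λ b → f [ b ] ≡ x
    encode x∈S b = surjective (Block⇒EvenCode x∈S b)

    block : ∀ b → Block (f [ b ])
    block b = EvenCode⇒Block (into b)

    f-∷≢[] : ∀ {b w} → f (b ∷ w) ≢ []
    f-∷≢[] {b} {w} eq =
      proj₁ (into b) (++-conicalˡ (f [ b ]) (f w) (trans (sym (homo [ b ] w)) eq))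

    loop : ∀ {i j} w → Path T i (f w) j → i ≡ j × All (λ b → Path T i (f [ b ]) i) w
    loop {i} {j} [] p with [] ← subst (λ x → Path T i x j) ε-homo p = refl , []
    loop {i} {j} (b ∷ w) p
      with Path-split (f [ b ]) (subst (λ x → Path T i x j) (homo [ b ] w) p)
    ... | _ , q , r with refl ← Block-loop (block b) q with loop w r
    ...   | refl , ps = refl , q ∷ ps

    mutual
      decode : ∀ {i} x → S x → Path T i x i → ∃ λ w → f w ≡ x
      decode []      _    _ = [] , ε-homo
      decode (a ∷ x) ax∈S (e ∷ p) with even? a
      ... | no o = decode-odd o [] x ax∈S p (Path-odd o e ∘ sym)
      ... | yes q with refl ← Path-even q e
                   with b , eq ← encode (prefix [ a ] x ax∈S) (even q)
                      | w , eq′ ← decode x (suffix [ a ] x ax∈S) p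
          = b ∷ w , trans (homo [ b ] w) (cong₂ _++_ eq eq′)

      decode-odd : ∀ {i j a e} → Odd a → All Even e → ∀ x → S (a ∷ e ++ x) →
                   Path T j x i → j ≢ i → ∃ λ w → f w ≡ a ∷ e ++ x
      decode-odd o ps [] _ [] j≢i = contradiction refl j≢i
      decode-odd {a = a} {e} o ps (c ∷ x) s (d ∷ p) j≢i with even? c
      ... | yes q with refl ← Path-even q d
                   with w , eq ← decode-odd o (∷ʳ⁺ ps q) x
                                  (subst S (cong (a ∷_) (sym (++-assoc e [ c ] x))) s) p j≢i
          = w , trans eq (cong (a ∷_) (++-assoc e [ c ] x))
      ... | no o′ with refl ← opposite (j≢i ∘ sym) (Path-odd o′ d)
                   with s′ ← subst S (cong (a ∷_) (sym (++-assoc e [ c ] x))) s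
                   with b , eq ← encode (prefix (a ∷ e ∷ʳ c) x s′) (odd o (Tail-∷ʳ ps o′))
                      | w , eq′ ← decode x (suffix (a ∷ e ∷ʳ c) x s′) p
          = b ∷ w , trans (homo [ b ] w)
              (trans (cong₂ _++_ eq eq′) (cong (a ∷_) (++-assoc e [ c ] x)))

    Decoded : Fin 2 → Pred (List B) 0ℓ
    Decoded i = f ⊢ PathWords S T i i

    Letters : Fin 2 → Pred B 0ℓ
    Letters i = lettersOver f (EvenCode S T ∩ PathWords S T i i)

    factorial : ∀ i → IsFactorial (Letters i) (Decoded i)
    factorial i = record
      { onAlphabet = λ {w} (_ , p) →
          All.map (λ {b} q → into b , EvenCode⇒S (into b) , q) (proj₂ (loop w p))
      ; letters    = proj₂
      ; factors    = factor
      }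
      where
      factor : ∀ {u w} → Factor u w → Decoded i w → Decoded i u
      factor {u} (p , q , refl) (s , r)
        with eq ← trans (homo p (u ++ q)) (cong (f p ++_) (homo u q))
        with Path-split (f p) (subst (λ x → Path T i x i) eq r)
      ... | _ , r₁ , r₂ with refl , _ ← loop p r₁ with Path-split (f u) r₂
      ...   | _ , r₃ , _ with refl , _ ← loop u r₃
        = factors isFactorial (f p , f q , eq) s , r₃

    recurrentᵈ : ∀ i {u w} → Decoded i u → Decoded i w →
                 ∃ λ v → Decoded i v × Decoded i (u ++ v ++ w)
    recurrentᵈ i {[]} {w} _ w∈ = [] , factors (factorial i) ([] , w , refl) w∈ , w∈
    recurrentᵈ i {u@(_ ∷ _)} {[]} u∈ _ =
      [] , factors (factorial i) ([] , u , refl) u∈ ,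
      subst (Decoded i) (sym (++-identityʳ u)) u∈
    recurrentᵈ i {u@(_ ∷ _)} {w@(_ ∷ _)} (u∈S , p) (w∈S , q) with recurrent u∈S w∈S
    ... | x , x∈S , s with path s
    ...   | _ , _ , r with Path-split (f u) r
    ...     | _ , r₁ , r₂ with Path-split x r₂
    ...       | _ , r₃ , r₄
      with refl ← Path-end-unique f-∷≢[] p r₁
         | refl ← Path-start-unique f-∷≢[] q r₄
      with v , refl ← decode x x∈S r₃
         = v , (x∈S , r₃) ,
           subst (PathWords S T i i)
             (sym (trans (homo u (v ++ w)) (cong (f u ++_) (homo v w))))
             (s , Path-++ p (Path-++ r₃ q))

    nonempty-word : ∀ i → ∃₂ λ b w → Decoded i (b ∷ w)
    nonempty-word i with around i
    ... | _ , a , _ , _ , _ , _ , (a∈i , _) ∷ []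
      with refl ← source-unique a∈i | a∈S ← letters isFactorial {a} _
      with v , _ , ava∈S ← recurrent a∈S a∈S
      with _ , r ← path-∷ ava∈S
      with _ , r₁ , r₂ ← Path-split (a ∷ v) {[ a ]} r
      with refl ← Path-start-unique (λ ()) (parityEdge a ∷ []) r₂
      with av∈S ← prefix (a ∷ v) [ a ] ava∈S
      with decode (a ∷ v) av∈S r₁
    ...   | [] , eq    = contradiction (trans (sym ε-homo) eq) λ ()
    ...   | b ∷ w , eq = b , w , subst (PathWords S T _ _) (sym eq) (av∈S , r₁)

    isRecurrent : ∀ i → IsRecurrent (Letters i) (Decoded i)
    isRecurrent i = record
      { nontrivial  = λ (decoded⊆[] , _) →
          case decoded⊆[] (proj₂ (proj₂ (nonempty-word i))) of λ ()
      ; isFactorial = factorial i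
      ; recurrent   = recurrentᵈ i
      }

    biextendable : ∀ i → IsBiextendable (Letters i) (Decoded i)
    biextendable i =
      recurrent⇒biextendable (factorial i) (recurrentᵈ i) (proj₂ (proj₂ (nonempty-word i)))

    extension-biTree : ∀ i {w} → Decoded i w → IsBiTree (λ a b → Decoded i (a ∷ w ∷ʳ b))
    extension-biTree i {w} (w∈S , p) =
      IsBiTree-pullback (λ a → reverse (f [ a ])) (λ b → f [ b ])
        (injective ∘ reverse-injective) injective E⇒F F⇒E onto
        (code-tree code-bound i (f w) (w∈S , -, -, [] , p))
      where
      F : Rel (List A) 0ℓ
      F u v = Block u × Block v × Around i u (f w ++ v)

      eq : ∀ a b → f (a ∷ w ∷ʳ b) ≡ reverse (reverse (f [ a ])) ++ f w ++ f [ b ]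
      eq a b = trans (homo [ a ] (w ∷ʳ b))
        (cong₂ _++_ (sym (reverse-involutive (f [ a ]))) (homo w [ b ]))

      E⇒F : ∀ {a b} → Decoded i (a ∷ w ∷ʳ b) → F (reverse (f [ a ])) (f [ b ])
      E⇒F {a} {b} (s , r)
        with Path-split (reverse (reverse (f [ a ]))) (subst (λ x → Path T i x i) (eq a b) r)
      ... | _ , r₁ , r₂
        with refl ← Block-loop (block a) (subst (λ x → Path T i x _) (reverse-involutive (f [ a ])) r₁)
        = Block-reverse (block a) , block b , subst S (eq a b) s , -, -, r₁ , r₂

      F⇒E : ∀ {a b} → F (reverse (f [ a ])) (f [ b ]) → Decoded i (a ∷ w ∷ʳ b)
      F⇒E {a} {b} (_ , _ , s , _ , _ , r₁ , r₂)
        with refl ← Block-loop (block a) (subst (λ x → Path T _ x i) (reverse-involutive (f [ a ])) r₁)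
        with Path-split (f w) r₂
      ... | _ , r₃ , r₄ with refl , _ ← loop w r₃ with refl ← Block-loop (block b) r₄
        = subst (PathWords S T i i) (sym (eq a b)) (s , Path-++ r₁ r₂)

      onto : ∀ {u v} → F u v → ∃₂ λ a b → reverse (f [ a ]) ≡ u × f [ b ] ≡ v
      onto {u} {v} (u∈ , v∈ , s , _)
        with encode (prefix (reverse u) (f w ++ v) s) (Block-reverse u∈)
           | encode (suffix (f w) v (suffix (reverse u) (f w ++ v) s)) v∈
      ... | a , eq₁ | b , eq₂ =
        a , b , trans (cong reverse eq₁) (reverse-involutive u) , eq₂

    extension-tree : ∀ i {w} → Decoded i w → IsTree (extensionGraph (factorial i) w)
    extension-tree i {w} w∈ =
      IsBiTree⇒IsTree {G = G} edge⇒E left-right nonempty adjacent (extension-biTree i w∈)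
      where
      open IsBiextendable (biextendable i) using () renaming (extendable to extendableᵈ)
      G : Graph (B ⊎ B)
      G = extensionGraph (factorial i) w

      edge⇒E : ∀ {x y} → edge G x y → BiEdge (λ a b → Decoded i (a ∷ w ∷ʳ b)) x y
      edge⇒E (left-right e) = forth e
      edge⇒E (right-left e) = back e

      nonempty : Satisfiable (vertex G)
      nonempty = let (a , _) , e = extendableᵈ w∈ in inj₁ a , edge⇒vertex G (left-right e)

      adjacent : ∀ {x} → vertex G x → ∃ λ y → edge G x y
      adjacent {inj₁ a} v = let (c , b) , e = extendableᵈ v in inj₂ b , left-right
        (factors (factorial i) ([ c ] , [] , cong (c ∷_) (sym (++-identityʳ _))) e)
      adjacent {inj₂ b} v = let (a , d) , e = extendableᵈ v in
        inj₁ a , right-left (factors (factorial i) ([] , [ d ] , refl) e)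

    isTreeSet : ∀ i → IsTreeSet (Letters i) (Decoded i) 1
    isTreeSet i = record
      { isBiextendable = biextendable i
      ; nonempty-tree  = λ w∈ _ → extension-tree i w∈
      ; empty-forest   = (λ _ → extensionGraph (factorial i) []) , record
        { vertices = (0F ,_) , proj₂
        ; edges    = (0F ,_) , proj₂
        ; disjoint = λ { {0F} {0F} _ _ → refl }
        ; trees    = λ _ → extension-tree i
            (factors (factorial i) ([] , _ , refl) (proj₂ (proj₂ (nonempty-word i))))
        }
      }

    decoding-≐ : (f ⊢ S) ≐ (Decoded 0F ∪ Decoded 1F)
    decoding-≐ = (λ {w} → split {w}) , Sum.[ proj₁ , proj₁ ]′
      where
      split : ∀ {w} → S (f w) → (Decoded 0F ∪ Decoded 1F) w
      split {w} s with path s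
      ... | i , _ , p with loop w p
      split {w} s | 0F , _ , p | refl , _ = inj₁ (s , p)
      split {w} s | 1F , _ , p | refl , _ = inj₂ (s , p)

theorem4p13 : ∀ {n m : ℕ}
    (θ : Fin n → Fin n) → Involutive _≡_ θ →
    (S : Pred (List (Fin n)) 0ℓ) (specular : IsSpecular θ S) → IsRecurrent U S →
    (T : Fin 2 → Graph (Fin n ⊎ Fin n)) →
    IsDisjointUnionOfTrees (extensionGraph (IsSpecular.isFactorial specular) []) T →
    (f : List (Fin m) → List (Fin n)) → IsCodingMorphism f (EvenCode S T) →
    (∀ (i : Fin 2) →
    IsRecurrent (lettersOver f (EvenCode S T ∩ PathWords S T i i)) (f ⊢ PathWords S T i i)
    × IsTreeSet (lettersOver f (EvenCode S T ∩ PathWords S T i i)) (f ⊢ PathWords S T i i) 1)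
    × (f ⊢ S) ≐ ((f ⊢ PathWords S T 0F 0F) ∪ (f ⊢ PathWords S T 1F 1F))
theorem4p13 θ _ S specular recurrent T union f coding =
  (λ i → isRecurrent i , isTreeSet i) , decoding-≐
  where
  open Parity Fin._≟_ (IsSpecular.isTreeSet specular) (IsRecurrent.recurrent recurrent) union
  open Decoding coding (proj₂ (bounded (λ b → length (f [ b ]))))
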